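{- Let $n$ be a positive integer and let $A(n)=(a_{ij})$, $p=p(n)$, $pp=pp(n)$, $b(n)$ be as in the context. Let $m\ge 1$ be an integer such that $\overline{p}=pm$ satisfies $\lfloor \overline{p}/2\rfloor> b(n)$, put $r=\lfloor\overline{p}/2\rfloor$, let $v$ be an integer with $v\ge pp+\overline{p}$, and let $B=(b_{ij})_{1\le i,j\le\overline{p}}$ be the $\overline{p}\times\overline{p}$ matrix with $b_{ij}=a_{v+i,v+j}$ if $i-r\le j\le i+r$; $b_{ij}=a_{v+i,v+j-\overline{p}}$ if $j>i+r$; $b_{ij}=a_{v+i,v+j+\overline{p}}$ if $j<i-r$. Then $B$ is symmetric.
   Context: $\mathbb{N}=\{1,2,3,\dots\}$. Fix a positive integer $n$. The infinite $\{0,1\}$-matrix $A(n)=(a_{ij})_{i,j\in\mathbb{N}}$ is defined recursively. Its entries are determined row by row (row $1$ first), and within each row from left to right, so that $a_{kl}$ is determined after all $a_{ij}$ with $i<k$ and all $a_{kj}$ with $j<l$. One sets $a_{kl}=1$ if and only if all of the following hold: (1) $\sum_{j<l}a_{kj}<n+1$; (2) $\sum_{i<k}a_{il}<n+1$; (3) there is no pair $(i,j)$ with $1\le i<k$, $1\le j<l$ and $a_{ij}=a_{il}=a_{kj}=1$. Otherwise $a_{kl}=0$. The matrix $A(n)$ is eventually periodic along the diagonal: there exist $c\ge0$, $q\ge1$ with $a_{i+q,j+q}=a_{ij}$ for all $i>c$, $j\ge1$. The period $p=p(n)$ is the smallest $q\ge1$ for which such a $c$ exists, and the preperiod $pp=pp(n)$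 is the smallest $c\ge 0$ with $a_{i+p,j+p}=a_{ij}$ for all $i>c$, $j\ge 1$. Define $b(n)=\max\{|j-i| : i,j\ge1,\ a_{ij}=1,\ i>pp(n)\}$. -}

module Defs where

open import Data.Fin using (Fin; toℕ)
open import Data.List using (_∷_; applyUpTo)
open import Data.Nat using (ℕ; zero; suc; _+_; _∸_; _≤_; _<_; z≤n; s≤s; ∣_-_∣)
open import Data.Nat.ListAction using (sum)
open import Data.Nat.Properties using (_≟_; _<?_; _≤?_; anyUpTo?; ≤-pred; ≤∧≢⇒<)
open import Data.Product using (_×_; _,_; ∃-syntax)
open import Function using (_⇔_; mk⇔; Equivalence; _∘_)
open import Relation.Binary.PropositionalEquality using (_≡_; refl; sym; trans; cong; cong₂; subst)
open import Relation.Nullary using (¬_; Dec; yes; no; contradiction; ¬?; _×-dec_)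

------------------------------------------------------------------------
-- Course-of-values recursion: `build d step m` is `step f m`, where
-- `f = prefix d step m` holds the values already built at all i < m
-- (see prefix-build) and the dummy value d elsewhere.

prefix : {X : Set} → X → ((ℕ → X) → ℕ → X) → ℕ → ℕ → X
prefix d step zero    i = d
prefix d step (suc m) i with i ≟ m
... | yes _ = step (prefix d step m) m
... | no  _ = prefix d step m i

build : {X : Set} → X → ((ℕ → X) → ℕ → X) → ℕ → X
build d step m = step (prefix d step m) m

prefix-build : {X : Set} (d : X) (step : (ℕ → X) → ℕ → X) →
               ∀ {m i} → i < m → prefix d step m i ≡ build d step i
prefix-build d step {suc m} {i} i<1+m with i ≟ m
... | yes refl = refl
... | no  i≢m  = prefix-build d step (≤∧≢⇒< (≤-pred i<1+m) i≢m)

------------------------------------------------------------------------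
-- The matrix A(n). Matrices are indexed by ℕ, but only the indices ≥ 1
-- are meaningful: the conditions below never consult index 0.

-- f 1 + f 2 + ⋯ + f (l - 1)
sumBelow : (ℕ → ℕ) → ℕ → ℕ
sumBelow f l = sum (applyUpTo (f ∘ suc) (l ∸ 1))

-- Rows i < k are read from `above`, the entries j < l of row k from `left`.
Corner : (above : ℕ → ℕ → ℕ) (left : ℕ → ℕ) (k l : ℕ) → Set
Corner above left k l =
  ∃[ i ] i < k × 1 ≤ i × ∃[ j ] j < l × 1 ≤ j ×
    above i j ≡ 1 × above i l ≡ 1 × left j ≡ 1

Admissible : (n : ℕ) (above : ℕ → ℕ → ℕ) (left : ℕ → ℕ) (k l : ℕ) → Set
Admissible n above left k l =
  sumBelow left l < n + 1 ×
  sumBelow (λ i → above i l) k < n + 1 ×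
  ¬ Corner above left k l

-- Opaque only so that conversion checking does not unfold it; which of the
-- two answers it gives is determined by its type.
opaque
  admissible? : ∀ n above left k l → Dec (Admissible n above left k l)
  admissible? n above left k l =
    (sumBelow left l <? n + 1) ×-dec
    (sumBelow (λ i → above i l) k <? n + 1) ×-dec
    ¬? (anyUpTo? (λ i → (1 ≤? i) ×-dec
          anyUpTo? (λ j → (1 ≤? j) ×-dec (above i j ≟ 1) ×-dec
                          (above i l ≟ 1) ×-dec (left j ≟ 1)) l) k)

indicator : {P : Set} → Dec P → ℕ
indicator (yes _) = 1
indicator (no  _) = 0

entry : (n : ℕ) (above : ℕ → ℕ → ℕ) (left : ℕ → ℕ) (k l : ℕ) → ℕ
entry n above left k l = indicator (admissible? n above left k l)

row : (n : ℕ) (above : ℕ → ℕ → ℕ) (k : ℕ) → ℕ → ℕ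
row n above k = build 0 (λ left l → entry n above left k l)

A : ℕ → ℕ → ℕ → ℕ
A n = build (λ _ → 0) (row n)

------------------------------------------------------------------------
-- A n satisfies its defining recursion: its entries are 0 or 1, and the
-- entry (k , l) is 1 exactly when it is admissible with respect to A n.

indicator-one : {P : Set} (P? : Dec P) → indicator P? ≡ 1 ⇔ P
indicator-one (yes p) = mk⇔ (λ _ → p) (λ _ → refl)
indicator-one (no ¬p) = mk⇔ (λ ()) (λ p → contradiction p ¬p)

indicator-zero : {P : Set} (P? : Dec P) → ¬ (indicator P? ≡ 1) → indicator P? ≡ 0
indicator-zero (yes _) ≢1 = contradiction refl ≢1
indicator-zero (no  _) _  = refl

applyUpTo-cong : ∀ {f g : ℕ → ℕ} m → (∀ {i} → i < m → f i ≡ g i) →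
                 applyUpTo f m ≡ applyUpTo g m
applyUpTo-cong zero    _   = refl
applyUpTo-cong (suc m) f≡g =
  cong₂ _∷_ (f≡g (s≤s z≤n)) (applyUpTo-cong m (f≡g ∘ s≤s))

sumBelow-cong : ∀ {f g : ℕ → ℕ} l → (∀ {i} → i < l → f i ≡ g i) →
                sumBelow f l ≡ sumBelow g l
sumBelow-cong zero    _   = refl
sumBelow-cong (suc l) f≡g = cong sum (applyUpTo-cong l (f≡g ∘ s≤s))

Admissible-cong : ∀ n k l {above above′ : ℕ → ℕ → ℕ} {left left′ : ℕ → ℕ} →
                  (∀ {i} → i < k → ∀ j → above i j ≡ above′ i j) →
                  (∀ {j} → j < l → left j ≡ left′ j) →
                  Admissible n above left k l → Admissible n above′ left′ k l
Admissible-cong n k l a≡ l≡ (rowOK , colOK , noCorner) =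
  subst (_< n + 1) (sumBelow-cong l l≡) rowOK ,
  subst (_< n + 1) (sumBelow-cong k (λ i<k → a≡ i<k l)) colOK ,
  λ (i , i<k , 1≤i , j , j<l , 1≤j , aij , ail , akj) →
    noCorner (i , i<k , 1≤i , j , j<l , 1≤j ,
              trans (a≡ i<k j) aij , trans (a≡ i<k l) ail , trans (l≡ j<l) akj)

A-one : ∀ n k l → A n k l ≡ 1 ⇔ Admissible n (A n) (A n k) k l
A-one n k l = mk⇔
  (Admissible-cong n k l above≡ left≡ ∘ to)
  (from ∘ Admissible-cong n k l (λ i<k j → sym (above≡ i<k j)) (λ j<l → sym (left≡ j<l)))
  where
  above : ℕ → ℕ → ℕ
  above = prefix (λ _ → 0) (row n) k

  left : ℕ → ℕ
  left = prefix 0 (λ left l → entry n above left k l) l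

  above≡ : ∀ {i} → i < k → ∀ j → above i j ≡ A n i j
  above≡ i<k j = cong (λ f → f j) (prefix-build (λ _ → 0) (row n) i<k)

  left≡ : ∀ {j} → j < l → left j ≡ A n k j
  left≡ = prefix-build 0 (λ left l → entry n above left k l)

  open Equivalence (indicator-one (admissible? n above left k l))

A-zero : ∀ n k l → ¬ (A n k l ≡ 1) → A n k l ≡ 0
A-zero n k l = indicator-zero (admissible? n _ _ k l)

------------------------------------------------------------------------
-- Period, preperiod and b(n), as predicates characterising their value.

IsLeast : (ℕ → Set) → ℕ → Set
IsLeast P x = P x × (∀ y → P y → x ≤ y)

IsGreatest : (ℕ → Set) → ℕ → Set
IsGreatest P x = P x × (∀ y → P y → y ≤ x)

PeriodicBeyond : (n c q : ℕ) → Set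
PeriodicBeyond n c q = ∀ i j → c < i → 1 ≤ j → A n (i + q) (j + q) ≡ A n i j

IsPeriod : (n p : ℕ) → Set
IsPeriod n = IsLeast (λ q → 1 ≤ q × ∃[ c ] PeriodicBeyond n c q)

-- p is meant to be the period of A n.
IsPreperiod : (n p pp : ℕ) → Set
IsPreperiod n p = IsLeast (λ c → PeriodicBeyond n c p)

-- pp is meant to be the preperiod of A n; b is the number b(n).
IsBandwidth : (n pp b : ℕ) → Set
IsBandwidth n pp = IsGreatest λ d →
  ∃[ i ] ∃[ j ] 1 ≤ i × 1 ≤ j × A n i j ≡ 1 × pp < i × ∣ j - i ∣ ≡ d

------------------------------------------------------------------------
-- The matrix B. The case conditions j > i + r and j < i - r are written
-- without subtraction; v + j ∸ p̄ is a true difference once p̄ ≤ v.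

bEntry : (n p̄ r v i j : ℕ) → ℕ
bEntry n p̄ r v i j with i + r <? j | j + r <? i
... | yes _ | _     = A n (v + i) (v + j ∸ p̄)
... | no  _ | yes _ = A n (v + i) (v + j + p̄)
... | no  _ | no  _ = A n (v + i) (v + j)

-- The index x : Fin p̄ stands for the 1-based index suc (toℕ x).
B : (n p̄ r v : ℕ) → Fin p̄ → Fin p̄ → ℕ
B n p̄ r v x y = bEntry n p̄ r v (suc (toℕ x)) (suc (toℕ y))

IsSymmetric : {N : ℕ} → (Fin N → Fin N → ℕ) → Set
IsSymmetric M = ∀ x y → M x y ≡ M y x

{-# OPTIONS --safe #-}

-- The rule defining the entry (k , l) is invariant under transposition and
-- only consults entries with a smaller index sum, so A n is symmetric. Inside
-- the band this is the symmetry of B; outside it, b_ij and b_ji are, up to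
-- transposition, entries of A n that differ by a diagonal shift by p̄.

module Submission where

open import Defs
open import Data.Fin using (toℕ)
open import Data.Nat using (ℕ; zero; suc; _+_; _*_; _∸_; _≤_; _<_; ⌊_/2⌋; z≤n; s≤s)
open import Data.Nat.Properties using (_≟_; _<?_; +-assoc; +-comm; +-identityʳ; +-mono-<; +-mono-≤; +-monoʳ-<; +-monoˡ-<; *-suc; *-zeroʳ; <-asym; m<n⇒0<n∸m; m∸n+n≡m; m+n≤o⇒m≤o; m+n≤o⇒n≤o; m≤n⇒m≤n+o)
open import Data.Nat.Induction using (<-wellFounded)
open import Data.Product using (_,_; proj₁)
open import Function using (Equivalence)
open import Induction.WellFounded using (Acc; acc)
open import Relation.Binary.PropositionalEquality using (_≡_; refl; sym; trans; cong; cong₂; subst; module ≡-Reasoning)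
open import Relation.Nullary using (yes; no; contradiction)

-- Transposing swaps the row-sum and column-sum conditions and sends a corner at `(i , j)` to one at
-- `(j , i)`. Each entry consulted has its row below `k` or its column below `l` and neither index
-- beyond these, so the symmetry hypothesis covers it.
Admissible-transpose : ∀ n k l (M : ℕ → ℕ → ℕ) →
  (∀ {i j} → i + j < k + l → M i j ≡ M j i) →
  Admissible n M (M k) k l → Admissible n M (M l) l k
Admissible-transpose n k l M M-sym (rowOK , colOK , noCorner) =
  subst (_< n + 1) (sumBelow-cong {λ i → M i l} {M l} k (λ {i} i<k → M-sym {i} {l} (+-monoˡ-< l i<k))) colOK ,
  subst (_< n + 1) (sumBelow-cong {M k} {λ j → M j k} l (λ {j} j<l → M-sym {k} {j} (+-monoʳ-< k j<l))) rowOK ,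
  λ (i , i<l , 1≤i , j , j<k , 1≤j , Mij , Mik , Mlj) →
    noCorner (j , j<k , 1≤j , i , i<l , 1≤i ,
              trans (M-sym (+-mono-< j<k i<l)) Mij ,
              trans (M-sym (+-monoˡ-< l j<k)) Mlj ,
              trans (M-sym (+-monoʳ-< k i<l)) Mik)

A-sym : ∀ n k l → A n k l ≡ A n l k
A-sym n k l = go k l (<-wellFounded (k + l))
  where
  one-transpose : ∀ k l → (∀ {i j} → i + j < k + l → A n i j ≡ A n j i) →
                  A n k l ≡ 1 → A n l k ≡ 1
  one-transpose k l ih Akl≡1 = Equivalence.from (A-one n l k)
    (Admissible-transpose n k l (A n) ih (Equivalence.to (A-one n k l) Akl≡1))

  go : ∀ k l → Acc _<_ (k + l) → A n k l ≡ A n l k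
  -- Entries are 0 or 1, so it is enough that a 1 at either position forces a 1 at the other.
  go k l (acc rs) with A n k l ≟ 1 | A n l k ≟ 1
  ... | yes Akl≡1 | yes Alk≡1 = trans Akl≡1 (sym Alk≡1)
  ... | no  Akl≢1 | no  Alk≢1 = trans (A-zero n k l Akl≢1) (sym (A-zero n l k Alk≢1))
  ... | yes Akl≡1 | no  Alk≢1 =
    contradiction (one-transpose k l (λ {i} {j} lt → go i j (rs lt)) Akl≡1) Alk≢1
  ... | no  Akl≢1 | yes Alk≡1 =
    contradiction (one-transpose l k (λ {i} {j} lt → go i j (rs (subst (i + j <_) (+-comm l k) lt))) Alk≡1) Akl≢1

-- The same `c` serves for every multiple, because a shift by `q` only increases the row index.
PeriodicBeyond-* : ∀ {n c q} → PeriodicBeyond n c q → ∀ m → PeriodicBeyond n c (q * m)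
PeriodicBeyond-* {n} {c} {q} per zero    i j c<i 1≤j
  rewrite *-zeroʳ q | +-identityʳ i | +-identityʳ j = refl
PeriodicBeyond-* {n} {c} {q} per (suc m) i j c<i 1≤j = begin
  A n (i + q * suc m) (j + q * suc m)    ≡⟨ cong₂ (A n) (shift i) (shift j) ⟩
  A n (i + q + q * m) (j + q + q * m)    ≡⟨ PeriodicBeyond-* per m (i + q) (j + q) (m≤n⇒m≤n+o q c<i) (m≤n⇒m≤n+o q 1≤j) ⟩
  A n (i + q) (j + q)                    ≡⟨ per i j c<i 1≤j ⟩
  A n i j                                ∎
  where
  open ≡-Reasoning
  shift : ∀ x → x + q * suc m ≡ x + q + q * m
  shift x = trans (cong (x +_) (*-suc q m)) (sym (+-assoc x q (q * m)))

module _ {n c p̄ v : ℕ} (per : PeriodicBeyond n c p̄) (c+p̄≤v : c + p̄ ≤ v) where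

  private
    p̄≤v : p̄ ≤ v
    p̄≤v = m+n≤o⇒n≤o c c+p̄≤v

  wrap-sym : ∀ i j → 1 ≤ i → 1 ≤ j → A n (v + i) (v + j ∸ p̄) ≡ A n (v + j) (v + i + p̄)
  wrap-sym i j 1≤i 1≤j = begin
    -- Periodicity is used backwards: shifting down the diagonal by `p̄` undoes the subtraction,
    -- which is not truncated since `p̄ ≤ v`.
    A n (v + i) (v + j ∸ p̄)             ≡⟨ per (v + i) (v + j ∸ p̄) c<v+i 1≤v+j∸p̄ ⟨
    A n (v + i + p̄) (v + j ∸ p̄ + p̄)     ≡⟨ cong (A n (v + i + p̄)) (m∸n+n≡m (m≤n⇒m≤n+o j p̄≤v)) ⟩
    A n (v + i + p̄) (v + j)             ≡⟨ A-sym n (v + i + p̄) (v + j) ⟩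
    A n (v + j) (v + i + p̄)             ∎
    where
    open ≡-Reasoning
    c<v+i : c < v + i
    c<v+i = subst (_≤ v + i) (+-comm c 1) (+-mono-≤ (m+n≤o⇒m≤o c c+p̄≤v) 1≤i)
    1≤v+j∸p̄ : 1 ≤ v + j ∸ p̄
    1≤v+j∸p̄ = m<n⇒0<n∸m (subst (_≤ v + j) (+-comm p̄ 1) (+-mono-≤ p̄≤v 1≤j))

  bEntry-sym : ∀ r i j → 1 ≤ i → 1 ≤ j → bEntry n p̄ r v i j ≡ bEntry n p̄ r v j i
  -- `bEntry` at `(j , i)` makes the same two tests in the opposite order, so this one case split
  -- reduces both sides.
  bEntry-sym r i j 1≤i 1≤j with i + r <? j | j + r <? i
  ... | yes i+r<j | yes j+r<i =
    -- Dropping `r` leaves both `i < j` and `j < i`.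
    contradiction (m+n≤o⇒m≤o (suc j) j+r<i) (<-asym (m+n≤o⇒m≤o (suc i) i+r<j))
  ... | yes _     | no  _     = wrap-sym i j 1≤i 1≤j
  ... | no  _     | yes _     = sym (wrap-sym j i 1≤j 1≤i)
  ... | no  _     | no  _     = A-sym n (v + i) (v + j)

theorem4p2 : (n : ℕ) → 1 ≤ n →
    (p pp b : ℕ) → IsPeriod n p → IsPreperiod n p pp → IsBandwidth n pp b →
    (m : ℕ) → 1 ≤ m → b < ⌊ p * m /2⌋ →
    (v : ℕ) → pp + p * m ≤ v →
    IsSymmetric (B n (p * m) ⌊ p * m /2⌋ v)
theorem4p2 n _ p pp b _ isPreperiod _ m _ _ v pp+pm≤v x y =
  -- Here `c` is `pp`: by its definition, `p` is a period beyond it.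
  bEntry-sym (PeriodicBeyond-* (proj₁ isPreperiod) m) pp+pm≤v
    ⌊ p * m /2⌋ (suc (toℕ x)) (suc (toℕ y)) (s≤s z≤n) (s≤s z≤n)
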